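{- For all $1\le i,j\le N$: $\mathbf{A}^{ -1}(i,j)=1$ if and only if $n_i\in R_{0\rightarrow j}$.
   Context: Let $G$ be a finite tree (connected acyclic simple graph) with nodes $n_0,n_1,\dots,n_N$, $N\ge 1$, where $n_0$ is a terminal node (degree one) and the nodes are indexed so that along the path in $G$ from $n_0$ to any node $n_i$ the successively encountered node indices strictly increase. Traveling forward means moving along edges with the node index strictly increasing at each step. Node $n_i$ is forward-adjacent to $n_k$ if $n_i$ and $n_k$ are adjacent and $i<k$. For $j\ge 1$, $R_{0\rightarrow j}$ denotes the (unique) route from $n_0$ to $n_j$ obtained by traveling forward, and $n_i\in R_{0\rightarrow j}$ means that $n_i$ is a node of this route, the terminal nodes $n_0$ and $n_j$ included. The forward adjacency matrix $\mathbf{A}$ of $G$ is the $N\times N$ matrix, with rows and columns indexed by $1,\dots,N$, given by $\mathbf{A}(i,j)=1$ if $i=j$, $\mathbf{A}(i,j)=-1$ if $n_i$ is forward-adjacent to $n_j$, and $\mathbf{A}(i,j)=0$ otherwise. The matrix $\mathbf{A}$ is invertible. -}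

module Defs where

open import Level using (0ℓ)
open import Algebra.Bundles using (Ring)
open import Data.Bool.Base using (if_then_else_)
open import Data.Nat.Base as ℕ using (ℕ; suc)
import Data.Nat.Properties as ℕP
open import Data.Fin.Base using (Fin; zero; suc; _<_; _≤_)
open import Data.Fin.Induction using (<-wellFounded)
open import Data.Fin.Properties
  using (_≟_; _<?_; ≤-refl; ≤-trans; <-trans; <-asym; <-cmp; <⇒≢)
open import Data.List.Base using (List; []; _∷_; _∷ʳ_; length; filter; allFin)
open import Data.List.Membership.Propositional using (_∈_)
open import Data.List.Relation.Unary.All as All using (All; []; _∷_)
open import Data.List.Relation.Unary.All.Properties using (¬Any⇒All¬)
open import Data.List.Relation.Unary.AllPairs using ([]; _∷_)
open import Data.List.Relation.Unary.Any using (here; there)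
open import Data.List.Relation.Unary.Linked using (Linked; _∷_)
open import Data.List.Relation.Unary.Unique.Propositional using (Unique)
open import Data.Product.Base using (Σ; _×_; _,_; proj₂)
open import Data.Rational.Base using (ℚ; 0ℚ; 1ℚ; -_; _*_)
open import Data.Rational.Properties using (+-*-ring)
open import Data.Sum.Base using (_⊎_; inj₁; inj₂)
open import Algebra.Properties.Semiring.Sum (Ring.semiring +-*-ring) using (sum)
open import Induction.WellFounded using (Acc; acc)
open import Relation.Binary.Core using (Rel)
open import Relation.Binary.Definitions
  using (Decidable; Symmetric; Irreflexive; tri<; tri≈; tri>)
open import Relation.Binary.Construct.Closure.ReflexiveTransitive
  using (Star; ε; _◅_)
open import Relation.Binary.PropositionalEquality
  using (_≡_; refl; sym; trans; cong)
open import Relation.Nullary.Decidable using (yes; no; does; _×-dec_)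
open import Relation.Nullary.Negation using (¬_; contradiction)

record SimpleGraph (n : ℕ) : Set₁ where
  infix 4 _~_ _~?_
  field
    _~_      : Rel (Fin n) 0ℓ
    _~?_     : Decidable _~_
    ~-sym    : Symmetric _~_
    ~-irrefl : Irreflexive _≡_ _~_

-- All nodes visited by a chain of steps, both ends included.
nodes : ∀ {n} {T : Rel (Fin n) 0ℓ} {u v} → Star T u v → List (Fin n)
nodes {u = u} ε       = u ∷ []
nodes {u = u} (_ ◅ w) = u ∷ nodes w

module _ {n : ℕ} (G : SimpleGraph n) where
  open SimpleGraph G

  Walk : Rel (Fin n) 0ℓ
  Walk = Star _~_

  record Path (u v : Fin n) : Set where
    constructor _,_
    field
      walk     : Walk u v
      distinct : Unique (nodes walk)

  pathNodes : ∀ {u v} → Path u v → List (Fin n)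
  pathNodes p = nodes (Path.walk p)

  -- A cycle is a path on at least three nodes whose ends are joined by an
  -- edge, which closes it up.
  record Cycle : Set where
    field
      {start end} : Fin n
      path        : Path start end
      long        : 3 ℕ.≤ length (pathNodes path)
      closing     : end ~ start

  Connected : Set
  Connected = ∀ u v → Walk u v

  Acyclic : Set
  Acyclic = ¬ Cycle

  record IsTree : Set where
    field
      connected : Connected
      acyclic   : Acyclic

  degree : Fin n → ℕ
  degree v = length (filter (v ~?_) (allFin n))

  Terminal : Fin n → Set
  Terminal v = degree v ≡ 1

  ForwardAdjacent : Rel (Fin n) 0ℓ
  ForwardAdjacent i k = i ~ k × i < k

  forwardAdjacent? : Decidable ForwardAdjacent
  forwardAdjacent? i k = (i ~? k) ×-dec (i <? k)

  ForwardRoute : Rel (Fin n) 0ℓ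
  ForwardRoute = Star ForwardAdjacent

  private
    open import Data.List.Membership.DecPropositional (_≟_ {n}) using (_∈?_)

    cutAt : ∀ {u v w} (p : Path u v) → w ∈ pathNodes p → Path w v
    cutAt p@(ε , _)           (here refl) = p
    cutAt p@(_ ◅ _ , _)       (here refl) = p
    cutAt (_ ◅ w , (_ ∷ ds))  (there m)   = cutAt (w , ds) m

    walk⇒path : ∀ {u v} → Walk u v → Path u v
    walk⇒path ε = ε , ([] ∷ [])
    walk⇒path {u} (e ◅ w) with walk⇒path w
    ... | p with u ∈? pathNodes p
    ...   | yes m = cutAt p m
    ...   | no ¬m = (e ◅ Path.walk p) , (¬Any⇒All¬ _ ¬m ∷ Path.distinct p)

    increasing⇒forward : ∀ {u v} (w : Walk u v) → Linked _<_ (nodes w) →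
                         ForwardRoute u v
    increasing⇒forward ε             _          = ε
    increasing⇒forward (e ◅ ε)       (lt ∷ _)   = (e , lt) ◅ ε
    increasing⇒forward (e ◅ w@(_ ◅ _)) (lt ∷ lts) =
      (e , lt) ◅ increasing⇒forward w lts

  path : Connected → ∀ u v → Path u v
  path conn u v = walk⇒path (conn u v)

  forwardRoute : ∀ {u v} (p : Path u v) → Linked _<_ (pathNodes p) →
                 ForwardRoute u v
  forwardRoute p = increasing⇒forward (Path.walk p)

module _ {N : ℕ} (G : SimpleGraph (suc N)) where
  open SimpleGraph G

  IncreasingFromRoot : Set
  IncreasingFromRoot = ∀ i (p : Path G zero i) → Linked _<_ (pathNodes G p)

  R₀→ : IsTree G → IncreasingFromRoot → ∀ j → ForwardRoute G zero j
  R₀→ tree incr j = forwardRoute G p (incr j p)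
    where p = path G (IsTree.connected tree) zero j

  private
    module _ {a b j} (a~j : a ~ j) (j~b : j ~ b) (a<b : a < b) (b<j : b < j)
      where

      extend : ∀ {u} → ForwardRoute G u a → Walk G u b
      extend ε             = a~j ◅ j~b ◅ ε
      extend ((e , _) ◅ p) = e ◅ extend p

      extend-≥ : ∀ {u} (p : ForwardRoute G u a) → All (u ≤_) (nodes (extend p))
      extend-≥ ε = ≤-refl ∷ ℕP.<⇒≤ (<-trans a<b b<j) ∷ ℕP.<⇒≤ a<b ∷ []
      extend-≥ ((_ , u<w) ◅ p) =
        ≤-refl ∷ All.map (≤-trans (ℕP.<⇒≤ u<w)) (extend-≥ p)

      extend-distinct : ∀ {u} (p : ForwardRoute G u a) →
                        Unique (nodes (extend p))
      extend-distinct ε =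
        (<⇒≢ (<-trans a<b b<j) ∷ <⇒≢ a<b ∷ []) ∷
        ((λ j≡b → <⇒≢ b<j (sym j≡b)) ∷ []) ∷ [] ∷ []
      extend-distinct {u} ((_ , u<w) ◅ p) =
        All.map (λ w≤x → <⇒≢ (ℕP.≤-trans u<w w≤x)) (extend-≥ p) ∷
        extend-distinct p

      extend-¬increasing : ∀ {u} (p : ForwardRoute G u a) →
                           ¬ Linked _<_ (nodes (extend p))
      extend-¬increasing ε (_ ∷ j<b ∷ _) = <-asym j<b b<j
      extend-¬increasing (_ ◅ ε) (_ ∷ l) = extend-¬increasing ε l
      extend-¬increasing (_ ◅ p@(_ ◅ _)) (_ ∷ l) = extend-¬increasing p l

    noSecondPredecessor : IncreasingFromRoot → ∀ {a b j} →
      ForwardRoute G zero a → ForwardAdjacent G a j → ForwardAdjacent G b j →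
      ¬ a < b
    noSecondPredecessor incr {b = b} p (a~j , _) (b~j , b<j) a<b =
      extend-¬increasing a~j j~b a<b b<j p
        (incr b (extend a~j j~b a<b b<j p , extend-distinct a~j j~b a<b b<j p))
      where j~b = ~-sym b~j

    LastStep : ∀ {u v} → ForwardRoute G u v → Set
    LastStep {u} {v} p =
      Σ (Fin (suc N)) λ a → Σ (ForwardRoute G u a) λ q →
      ForwardAdjacent G a v × nodes p ≡ nodes q ∷ʳ v

    unsnoc : ∀ {u v} (p : ForwardRoute G u v) →
             (u ≡ v × nodes p ≡ v ∷ []) ⊎ LastStep p
    unsnoc ε = inj₁ (refl , refl)
    unsnoc {u} (f ◅ p) with unsnoc p
    ... | inj₁ (refl , eq)      = inj₂ (u , ε , f , cong (u ∷_) eq)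
    ... | inj₂ (a , q , g , eq) = inj₂ (a , f ◅ q , g , cong (u ∷_) eq)

    unique : IncreasingFromRoot → ∀ {j} → Acc _<_ j →
             (p q : ForwardRoute G zero j) → nodes p ≡ nodes q
    unique incr (acc rec) p q with unsnoc p | unsnoc q
    ... | inj₁ (_ , eq) | inj₁ (_ , eq′) = trans eq (sym eq′)
    ... | inj₁ (refl , _) | inj₂ (_ , _ , (_ , ()) , _)
    ... | inj₂ (_ , _ , (_ , ()) , _) | inj₁ (refl , _)
    ... | inj₂ (a , p′ , f , eq) | inj₂ (b , q′ , g , eq′) with <-cmp a b
    ...   | tri< a<b _ _ = contradiction a<b (noSecondPredecessor incr p′ f g)
    ...   | tri> _ _ b<a = contradiction b<a (noSecondPredecessor incr q′ g f)
    ...   | tri≈ _ refl _ =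
      trans eq (trans (cong (_∷ʳ _) (unique incr (rec (proj₂ f)) p′ q′))
                      (sym eq′))

  -- R₀→ is built from whichever walk the connectedness proof supplies; the
  -- choice is immaterial, since every forward route has the same nodes.
  R₀→-unique : ∀ tree incr {j} (p : ForwardRoute G zero j) →
               nodes p ≡ nodes (R₀→ tree incr j)
  R₀→-unique tree incr {j} p =
    unique incr (<-wellFounded j) p (R₀→ tree incr j)

Matrix : ℕ → Set
Matrix n = Fin n → Fin n → ℚ

identity : ∀ {n} → Matrix n
identity i j = if does (i ≟ j) then 1ℚ else 0ℚ

infixl 7 _⊗_
_⊗_ : ∀ {n} → Matrix n → Matrix n → Matrix n
(M ⊗ M′) i j = sum λ k → M i k * M′ k j

record IsInverse {n : ℕ} (M M⁻¹ : Matrix n) : Set where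
  field
    inverseˡ : ∀ i j → (M⁻¹ ⊗ M) i j ≡ identity i j
    inverseʳ : ∀ i j → (M ⊗ M⁻¹) i j ≡ identity i j

-- The root has no row or column: the index i : Fin N belongs to the node
-- suc i : Fin (suc N).
forwardAdjacencyMatrix : ∀ {N} → SimpleGraph (suc N) → Matrix N
forwardAdjacencyMatrix G i j =
  if does (i ≟ j) then 1ℚ
  else if does (forwardAdjacent? G (suc i) (suc j)) then - 1ℚ
  else 0ℚ

{-# OPTIONS --safe #-}

-- Since A⁻¹ A = I, row i of A⁻¹, extended by 0 at the root, changes by δᵢⱼ along
-- a forward edge into nⱼ: the forward predecessor of a node is unique, so column j
-- of A has no off-diagonal entry but the one of that predecessor.  Along R₀→ⱼ the
-- row therefore starts at 0 and jumps to 1 on entering nᵢ, if it ever does; the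
-- node indices increase, so it jumps only once.

module Submission where

open import Level using (0ℓ)
open import Algebra.Bundles using (Ring)
open import Data.Bool.Base using (if_then_else_)
open import Data.Nat.Base using (ℕ; suc; _≤_)
import Data.Nat.Properties as ℕ
open import Data.Fin.Base using (Fin; zero; suc; _<_)
import Data.Fin.Base as Fin
open import Data.Fin.Properties using (_≟_; ≤-refl; ≤-trans; <⇒≢)
open import Data.List.Base using ([]; _∷_; _∷ʳ_)
open import Data.List.Properties using (∷ʳ-injectiveˡ; ∷-injectiveʳ)
open import Data.List.Membership.Propositional using (_∈_; _∉_)
open import Data.List.Relation.Unary.All as All using (All; []; _∷_)
open import Data.List.Relation.Unary.Any using (here; there)
open import Data.Product.Base using (_,_)
open import Data.Rational.Base using (ℚ; 0ℚ; 1ℚ; -_; _+_; _*_)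
open import Data.Rational.Properties
  using ( +-*-ring; +-identityˡ; +-identityʳ; *-identityʳ; *-zeroˡ; *-zeroʳ
        ; *-distribˡ-+)
open import Data.Vec.Functional as Vector using (Vector; replicate)
open import Algebra.Properties.Semiring.Sum (Ring.semiring +-*-ring)
  using (sum; sum-cong-≗; sum-replicate-zero; ∑-distrib-+)
open import Function.Base using (_∘_)
open import Function.Bundles using (_⇔_; mk⇔)
open import Relation.Binary.Core using (Rel)
open import Relation.Binary.Construct.Closure.ReflexiveTransitive
  using (Star; ε; _◅_; _◅◅_)
open import Relation.Binary.PropositionalEquality
  using (_≡_; _≢_; refl; sym; trans; cong; cong₂; module ≡-Reasoning)
open import Relation.Nullary.Decidable using (yes; no; dec-true; dec-false)
open import Relation.Nullary.Negation using (contradiction)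
open import Defs

identity-diag : ∀ {n} (i : Fin n) → identity i i ≡ 1ℚ
identity-diag i = cong (if_then 1ℚ else 0ℚ) (dec-true (i ≟ i) refl)

identity-off-diag : ∀ {n} {i j : Fin n} → i ≢ j → identity i j ≡ 0ℚ
identity-off-diag {i = i} {j} i≢j =
  cong (if_then 1ℚ else 0ℚ) (dec-false (i ≟ j) i≢j)

sum-*-identity : ∀ {n} (f : Vector ℚ n) v → sum (λ k → f k * identity k v) ≡ f v
sum-*-identity {suc n} f zero = begin
  f zero * 1ℚ + sum (λ k → f (suc k) * 0ℚ)
    ≡⟨ cong₂ _+_ (*-identityʳ (f zero)) (sum-cong-≗ (*-zeroʳ ∘ f ∘ suc)) ⟩
  f zero + sum (replicate n 0ℚ)  ≡⟨ cong (f zero +_) (sum-replicate-zero n) ⟩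
  f zero + 0ℚ                    ≡⟨ +-identityʳ _ ⟩
  f zero                         ∎
  where open ≡-Reasoning
sum-*-identity f (suc v) =
  trans (cong₂ _+_ (*-zeroʳ (f zero)) (sum-*-identity (f ∘ suc) v)) (+-identityˡ _)

module _ {n} {T : Rel (Fin n) 0ℓ} where

  nodes-◅◅-∷ʳ : ∀ {u v w} (p : Star T u v) (t : T v w) →
                nodes (p ◅◅ t ◅ ε) ≡ nodes p ∷ʳ w
  nodes-◅◅-∷ʳ ε       t = refl
  nodes-◅◅-∷ʳ (_ ◅ p) t = cong (_ ∷_) (nodes-◅◅-∷ʳ p t)

  nodes-determine-end : ∀ {u u′ v w} (p : Star T u v) (q : Star T u′ w) →
                        nodes p ≡ nodes q → v ≡ w
  nodes-determine-end ε           ε           refl = refl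
  -- The rest of the longer chain is matched too, since only then does `nodes` show a second entry
  -- and the lengths visibly clash.
  nodes-determine-end ε           (_ ◅ ε)     ()
  nodes-determine-end ε           (_ ◅ _ ◅ _) ()
  nodes-determine-end (_ ◅ ε)     ε           ()
  nodes-determine-end (_ ◅ _ ◅ _) ε           ()
  nodes-determine-end (_ ◅ p)     (_ ◅ q)     eq   =
    nodes-determine-end p q (∷-injectiveʳ eq)

module _ {n} (G : SimpleGraph n) where

  source-≤ : ∀ {u v} (p : ForwardRoute G u v) → All (u Fin.≤_) (nodes p)
  source-≤ ε               = ≤-refl ∷ []
  source-≤ ((_ , u<w) ◅ p) = ≤-refl ∷ All.map (≤-trans (ℕ.<⇒≤ u<w)) (source-≤ p)

  source-∈ : ∀ {u v} (p : ForwardRoute G u v) → u ∈ nodes p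
  source-∈ ε       = here refl
  source-∈ (_ ◅ _) = here refl

  -- Indices only grow along a forward route, so a node left behind cannot be met again.
  ∉-beyond : ∀ {r u v} (p : ForwardRoute G u v) → r < u → r ∉ nodes p
  ∉-beyond p r<u r∈ = ℕ.<⇒≱ r<u (All.lookup (source-≤ p) r∈)

  module _ (b : Vector ℚ n) (r : Fin n)
           (step : ∀ u w → ForwardAdjacent G u w → b w ≡ identity r w + b u)
           where

    step-≢ : ∀ {u w} → ForwardAdjacent G u w → r ≢ w → b w ≡ b u
    step-≢ {u} {w} e r≢w =
      trans (step u w e) (trans (cong (_+ b u) (identity-off-diag r≢w)) (+-identityˡ _))

    constant-off-route : ∀ {u v} (p : ForwardRoute G u v) → r ∉ nodes p → b v ≡ b u
    constant-off-route ε       _  = refl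
    constant-off-route (e ◅ p) r∉ =
      trans (constant-off-route p (r∉ ∘ there))
            (step-≢ e λ { refl → r∉ (there (source-∈ p)) })

    -- The premise on `b u` is the invariant carried along the route up to `r`: the value is 0
    -- before `r` and already 1 at `r` itself. Past `r` no further jump occurs, as `r` does not
    -- recur.
    one-on-route : ∀ {u v} (p : ForwardRoute G u v) → b u ≡ identity r u →
                   r ∈ nodes p → b v ≡ 1ℚ
    one-on-route ε bu (here refl) = trans bu (identity-diag r)
    one-on-route (e@(_ , r<w) ◅ p) bu (here refl) =
      trans (constant-off-route p (∉-beyond p r<w))
            (trans (step-≢ e (<⇒≢ r<w)) (trans bu (identity-diag r)))
    one-on-route {u} (_◅_ {j = w} e@(_ , u<w) p) bu (there r∈) =
      one-on-route p bw r∈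
      where
      r≢u : r ≢ u
      r≢u refl = ∉-beyond p u<w r∈

      bw : b w ≡ identity r w
      bw = trans (step u w e)
        (trans (cong (identity r w +_) (trans bu (identity-off-diag r≢u)))
               (+-identityʳ _))

module _ {N : ℕ} (G : SimpleGraph (suc N)) (tree : IsTree G)
         (incr : IncreasingFromRoot G) where

  private
    A : Matrix N
    A = forwardAdjacencyMatrix G

  -- Appending the last edge to the routes from the root to `a` and to `b` gives two forward routes
  -- to `v`. These have the same nodes, so dropping `v` leaves equal lists, whose last entries are
  -- `a` and `b`.
  predecessor-unique : ∀ {a b v} → ForwardAdjacent G a v → ForwardAdjacent G b v →
                       a ≡ b
  predecessor-unique {a} {b} {v} e f =
    nodes-determine-end (route a) (route b)
      (∷ʳ-injectiveˡ _ _ (trans (extended e) (sym (extended f))))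
    where
    route : ∀ c → ForwardRoute G zero c
    route = R₀→ G tree incr

    extended : ∀ {c} → ForwardAdjacent G c v →
               nodes (route c) ∷ʳ v ≡ nodes (route v)
    extended {c} e = trans (sym (nodes-◅◅-∷ʳ (route c) e))
                           (R₀→-unique G tree incr (route c ◅◅ e ◅ ε))

  -- A k j = δₖⱼ − δₖᵤ, for u the predecessor of j, without the subtraction.
  column : ∀ {u j} → ForwardAdjacent G u (suc j) →
           ∀ k → A k j + identity (suc k) u ≡ identity k j
  column {u} {j} e@(_ , u<j) k with k ≟ j
  ... | yes refl = cong (1ℚ +_) (identity-off-diag (<⇒≢ u<j ∘ sym))
  ... | no _ with forwardAdjacent? G (suc k) (suc j)
  -- Uniqueness of the predecessor forces `u` to be `suc k`, so the entry -1 cancels against the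
  -- added 1.
  ...   | yes f with refl ← predecessor-unique f e =
    cong₂ _+_
      (cong (if_then - 1ℚ else 0ℚ) (dec-true (forwardAdjacent? G (suc k) (suc j)) f))
      (identity-diag (suc k))
  ...   | no ¬f =
    cong₂ _+_
      (cong (if_then - 1ℚ else 0ℚ) (dec-false (forwardAdjacent? G (suc k) (suc j)) ¬f))
      (identity-off-diag {i = suc k} {u} λ { refl → ¬f e })

  module _ (x : Vector ℚ N) where

    private
      x₀ : Vector ℚ (suc N)
      x₀ = 0ℚ Vector.∷ x

    -- Both sides come from pairing `x` with column `j` of the identity, which `column` splits into
    -- the column of `A` and the indicator of `u`.
    sum-column : ∀ {u j} → ForwardAdjacent G u (suc j) →
                 x j ≡ sum (λ k → x k * A k j) + x₀ u
    sum-column {u} {j} e = begin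
      x j
        ≡⟨ sum-*-identity x j ⟨
      sum (λ k → x k * identity k j)
        ≡⟨ sum-cong-≗ (λ k → cong (x k *_) (column e k)) ⟨
      sum (λ k → x k * (A k j + identity (suc k) u))
        ≡⟨ sum-cong-≗ (λ k → *-distribˡ-+ (x k) (A k j) (identity (suc k) u)) ⟩
      sum (λ k → x k * A k j + x k * identity (suc k) u)
        ≡⟨ ∑-distrib-+ (λ k → x k * A k j) (λ k → x k * identity (suc k) u) ⟩
      sum (λ k → x k * A k j) + sum (λ k → x k * identity (suc k) u)
        ≡⟨ cong (sum (λ k → x k * A k j) +_) off-root ⟩
      sum (λ k → x k * A k j) + x₀ u
        ∎
      where
      open ≡-Reasoning

      -- The predecessor `u` may be the root, which has no index in `Fin N`. Prepending the zero
      -- term of `x₀` turns the sum into one over all nodes, where the indicator of `u` picks out a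
      -- single value.
      off-root : sum (λ k → x k * identity (suc k) u) ≡ x₀ u
      off-root = begin
        sum (λ k → x k * identity (suc k) u)
          ≡⟨ +-identityˡ _ ⟨
        0ℚ + sum (λ k → x k * identity (suc k) u)
          ≡⟨ cong (_+ sum (λ k → x k * identity (suc k) u)) (*-zeroˡ (identity zero u)) ⟨
        sum (λ k → x₀ k * identity k u)
          ≡⟨ sum-*-identity x₀ u ⟩
        x₀ u
          ∎

theorem13 : (N : ℕ) → 1 ≤ N →
    (G : SimpleGraph (suc N)) (tree : IsTree G) →
    Terminal G zero →
    (incr : IncreasingFromRoot G) →
    (A⁻¹ : Matrix N) → IsInverse (forwardAdjacencyMatrix G) A⁻¹ →
    (i j : Fin N) →
    (A⁻¹ i j ≡ 1ℚ) ⇔ (suc i ∈ nodes (R₀→ G tree incr (suc j)))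
theorem13 N _ G tree _ incr A⁻¹ inv i j =
  -- The invariant at the root holds by computation: `b zero` is 0, and `suc i` is not the root.
  mk⇔ one⇒∈ (one-on-route G b (suc i) step route refl)
  where
  open import Data.List.Membership.DecPropositional (_≟_ {suc N}) using (_∈?_)

  route : ForwardRoute G zero (suc j)
  route = R₀→ G tree incr (suc j)

  b : Vector ℚ (suc N)
  b = 0ℚ Vector.∷ A⁻¹ i

  step : ∀ u w → ForwardAdjacent G u w → b w ≡ identity (suc i) w + b u
  step _ zero    (_ , ())
  step u (suc k) e =
    trans (sum-column G tree incr (A⁻¹ i) e) (cong (_+ b u) (IsInverse.inverseˡ inv i k))

  one⇒∈ : A⁻¹ i j ≡ 1ℚ → suc i ∈ nodes route
  one⇒∈ one with suc i ∈? nodes route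
  ... | yes i∈ = i∈
  ... | no  i∉ =
    -- A route that misses `suc i` keeps the root's value 0 up to its end, where `one` demands 1.
    contradiction (trans (sym (constant-off-route G b (suc i) step route i∉)) one) λ ()
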